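{- Let $G$ be a finite, simple, connected, undirected graph. Then the Lovász complex $\mathsf{L}(G)$ and the halved doubled Lovász complex $\mathsf{HDL}(G)$ are $\mathbb{Z}_2$-isomorphic, i.e. there is an isomorphism of simplicial complexes $\mathsf{L}(G)\to\mathsf{HDL}(G)$ that commutes with the simplicial $\mathbb{Z}_2$-actions.
   Context: $V(G)$ is the node set of $G$. For $A\subseteq V(G)$, $\mathrm{CN}(A)$ is the set of all nodes adjacent to every $a\in A$, with $\mathrm{CN}(\emptyset)=V(G)$; $\mathrm{CN}^2(A)=\mathrm{CN}(\mathrm{CN}(A))$. The neighborhood complex $\mathsf{N}(G)$ is the abstract simplicial complex whose simplices are the sets $A\subseteq V(G)$ with $\mathrm{CN}(A)\ne\emptyset$. A chain $\mathcal{A}$ is a (possibly empty) family $A_1\subset\dots\subset A_p$ of strictly increasing subsets of $V(G)$. For sets $A,B$ put $A\uplus B:=\{(a,0):a\in A\}\cup\{(b,1):b\in B\}$. Lovász complex: $\mathsf{L}(G)$ is the subcomplex of the barycentric subdivision $\mathrm{sd}(\mathsf{N}(G))$ induced by the fixed points of $\mathrm{CN}^2$. That is, its vertices are the nonempty sets $A\subseteq V(G)$ with $\mathrm{CN}(A)\ne\emptyset$ and $\mathrm{CN}^2(A)=A$, and its simplices are the chains of such sets. Its free simplicial $\mathbb{Z}_2$-action is $A\mapsto\mathrm{CN}(A)$ on vertices. Box complex: $\mathsf{B}(G):=\{A\uplus B: A,B\in\mathsf{N}(G),\ A\subseteq\mathrm{CN}(B),\ B\subseteq\mathrm{CN}(A)\}$,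 with the $\mathbb{Z}_2$-action $A\uplus B\mapsto B\uplus A$. Its two shores are the subcomplexes induced by the vertices $(v,0)$ and by the vertices $(v,1)$, respectively. Shore subdivision: $\mathrm{ssd}(\mathsf{B}(G))$ is the simplicial complex consisting of the simplices of the joins $\mathrm{sd}(\sigma\cap K_1)*\mathrm{sd}(\sigma\cap K_2)$, $\sigma\in\mathsf{B}(G)$, where $K_1,K_2$ are the two shores. Explicitly: its vertices are denoted $A\uplus\emptyset$ (first shore) and $\emptyset\uplus A$ (second shore), for $\emptyset\neq A\subseteq V(G)$ with $\mathrm{CN}(A)\neq\emptyset$. Its simplices are denoted $\mathcal{A}\uplus\mathcal{B}$, spanned by the vertices $A\uplus\emptyset$ ($A\in\mathcal{A}$) and $\emptyset\uplus B$ ($B\in\mathcal{B}$), where $\mathcal{A},\mathcal{B}$ are chains of such sets with $A\subseteq\mathrm{CN}(B)$ for all $A\in\mathcal{A}$, $B\in\mathcal{B}$. Its $\mathbb{Z}_2$-action interchanges $A\uplus\emptyset$ and $\emptyset\uplus A$. Doubled Lovász complex: $\mathsf{DL}(G)$ is the image of the simplicial $\mathbb{Z}_2$-map $\mathrm{ssd}(\mathsf{B}(G))\to\mathrm{ssd}(\mathsf{B}(G))$ given on vertices by $A\uplus\emptyset\mapsto\mathrm{CN}^2(A)\uplus\emptyset$ and $\emptyset\uplus A\mapsto\emptyset\uplus\mathrm{CN}^2(A)$. Explicitly, $\mathsf{DL}(G)$ consists of all $\mathcal{A}\uplus\mathcal{B}$ with $\mathcal{A},\mathcal{B}\in\mathsf{L}(G)$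 (possibly empty) such that every $a\in A$ is adjacent to every $b\in B$ for all $A\in\mathcal{A}$, $B\in\mathcal{B}$. Halved doubled Lovász complex: fix a linear order on $V(G)$ and define a linear order $\prec$ on the vertices of $\mathsf{L}(G)$ by $A\prec B$ iff $|A|<|B|$, or $|A|=|B|$ and $A<_{\mathrm{lex}}B$ (lexicographic order). The vertices of $\mathsf{DL}(G)$ are partitioned into pairs $\{A\uplus\emptyset,\ \emptyset\uplus\mathrm{CN}(A)\}$, and each pair is ordered by: $A\uplus\emptyset\prec\emptyset\uplus\mathrm{CN}(A)$ iff $A\prec\mathrm{CN}(A)$ (otherwise $\emptyset\uplus\mathrm{CN}(A)$ is the smaller one). Define the simplicial $\mathbb{Z}_2$-map $j:\mathsf{DL}(G)\to\mathsf{DL}(G)$ on vertices by $j(A\uplus\emptyset)=\min_\prec\{A\uplus\emptyset,\emptyset\uplus\mathrm{CN}(A)\}$ and $j(\emptyset\uplus B)=\min_\prec\{\emptyset\uplus B,\mathrm{CN}(B)\uplus\emptyset\}$. Then $\mathsf{HDL}(G):=\operatorname{im} j=\{j(\sigma):\sigma\in\mathsf{DL}(G)\}$, with the $\mathbb{Z}_2$-action inherited from $\mathsf{DL}(G)\subseteq\mathrm{ssd}(\mathsf{B}(G))$, interchanging $A\uplus\emptyset$ and $\emptyset\uplus A$. -}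

module Defs where

open import Data.Bool.Base using (if_then_else_)
import Data.Bool.Properties as Bool
open import Data.Empty using (⊥-elim)
open import Data.Fin.Base using (Fin)
open import Data.Fin.Properties using (all?)
import Data.Fin.Properties as Fin
open import Data.Fin.Subset using (Subset; _∈_; _⊆_; _⊂_; ⊥; Nonempty; ∣_∣)
open import Data.Fin.Subset.Properties using (_∈?_; ⊆-antisym; ⊂-trans; p⊂q⇒p⊆q; ∉⊥)
open import Data.List.Base using (List; []; _∷_; [_]; _++_; map; filter; allFin)
open import Data.List.Membership.Propositional using () renaming (_∈_ to _∈ˡ_)
import Data.List.Membership.DecPropositional as DecMembership
open import Data.List.Membership.Propositional.Properties
  using (∈-map⁺; ∈-map⁻; ∈-++⁺ˡ; ∈-++⁺ʳ; ∈-++⁻; ∈-filter⁺; ∈-filter⁻; ∈-allFin)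
open import Data.List.Relation.Binary.BagAndSetEquality using (_∼[_]_; set)
open import Data.List.Relation.Binary.Lex.NonStrict using (Lex-<; <-compare; <-decidable)
open import Data.List.Relation.Binary.Permutation.Propositional using (↭-sym)
open import Data.List.Relation.Binary.Permutation.Propositional.Properties using (∈-resp-↭)
open import Data.List.Relation.Binary.Pointwise using (Pointwise-≡⇒≡; ≡⇒Pointwise-≡)
open import Data.List.Relation.Binary.Subset.Propositional using () renaming (_⊆_ to _⊆ˡ_)
open import Data.List.Relation.Unary.All using (All; []; _∷_)
import Data.List.Relation.Unary.All as All
open import Data.List.Relation.Unary.AllPairs using (AllPairs; []; _∷_)
import Data.List.Relation.Unary.AllPairs.Properties as AllPairs
open import Data.List.Relation.Unary.Any using (here; there)
open import Data.List.Relation.Unary.Linked using (Linked; _∷_)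
open import Data.List.Relation.Unary.Linked.Properties using (AllPairs⇒Linked; Linked⇒AllPairs)
import Data.List.Sort as Sort
open import Data.Nat.Base using (ℕ; _<_)
import Data.Nat.Properties as ℕ
import Data.Product.Base as Prod
open import Data.Product.Base using (∃; ∃₂; _×_; _,_; proj₁; proj₂)
open import Data.Sum.Base using (_⊎_; inj₁; inj₂; swap)
import Data.Sum.Base as Sum
import Data.Sum.Properties as Sum
open import Data.Vec.Base using (tabulate)
import Data.Vec.Properties as Vec
open import Function.Base using (_∘_; id)
open import Function.Bundles using (Equivalence; mk⇔)
open import Level using (0ℓ)
open import Relation.Binary.Bundles using (DecTotalOrder)
open import Relation.Binary.Construct.Closure.ReflexiveTransitive using (Star)
open import Relation.Binary.Core using (Rel)
open import Relation.Binary.Definitions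
  using (Decidable; DecidableEquality; Symmetric; Irreflexive; Tri; tri<; tri≈; tri>)
open import Relation.Binary.PropositionalEquality
  using (_≡_; _≢_; refl; sym; trans; cong; subst)
open import Relation.Binary.Structures using (IsDecTotalOrder)
open import Relation.Nullary using (Dec; does; yes; no; ¬?; _→-dec_; _×-dec_; _⊎-dec_)
open import Relation.Nullary.Decidable using (dec-true; dec-false)
open import Relation.Unary using (Pred)

open Equivalence using (to; from)

-- A finite set of points is represented by a list having these points as
-- its elements; `Face` is closed under `_⊆ˡ_`, so it depends neither on the
-- order nor on the multiplicity of the entries.  The ambient type `X` may
-- contain points that are not vertices.
record Complex (X : Set) : Set₁ where
  field
    Face   : Pred (List X) 0ℓ
    closed : ∀ {σ τ} → σ ⊆ˡ τ → Face τ → Face σ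

  Vertex : Pred X 0ℓ
  Vertex x = Face [ x ]

  vertex : ∀ {σ x} → Face σ → x ∈ˡ σ → Vertex x
  vertex Fσ x∈σ = closed (λ { (here refl) → x∈σ }) Fσ

-- A simplicial map is given by a function on the ambient types; only its
-- values on vertices are relevant.
record SimplicialMap {X Y : Set} (K : Complex X) (L : Complex Y) : Set where
  private
    module K = Complex K
    module L = Complex L
  field
    fun      : X → Y
    fun-face : ∀ {σ} → K.Face σ → L.Face (map fun σ)

record ℤ₂Complex (X : Set) : Set₁ where
  field
    complex : Complex X
    action  : SimplicialMap complex complex

  open Complex complex public
  open SimplicialMap action public renaming (fun to ν; fun-face to ν-face)

  field
    ν-involutive : ∀ {x} → Vertex x → ν (ν x) ≡ x

infix 4 _≅_

record _≅_ {X Y : Set} (K : ℤ₂Complex X) (L : ℤ₂Complex Y) : Set where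
  private
    module K = ℤ₂Complex K
    module L = ℤ₂Complex L
  field
    forward  : SimplicialMap K.complex L.complex
    backward : SimplicialMap L.complex K.complex

  private
    f = SimplicialMap.fun forward
    g = SimplicialMap.fun backward

  field
    inverseˡ    : ∀ {x} → K.Vertex x → g (f x) ≡ x
    inverseʳ    : ∀ {y} → L.Vertex y → f (g y) ≡ y
    equivariant : ∀ {x} → K.Vertex x → f (K.ν x) ≡ L.ν (f x)

private
  unmap : ∀ {X Y : Set} (f : X → Y) {ρ} τ → τ ⊆ˡ map f ρ →
          ∃ λ ρ′ → ρ′ ⊆ˡ ρ × τ ≡ map f ρ′
  unmap f [] _ = [] , (λ ()) , refl
  unmap f (y ∷ τ) τ⊆ with ∈-map⁻ f (τ⊆ (here refl)) | unmap f τ (τ⊆ ∘ there)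
  ... | x , x∈ρ , refl | ρ′ , ρ′⊆ρ , refl =
    x ∷ ρ′ , (λ { (here refl) → x∈ρ ; (there p) → ρ′⊆ρ p }) , refl

image : ∀ {X Y : Set} → (X → Y) → Complex X → Complex Y
image f K = record
  { Face   = λ τ → ∃ λ σ → Face σ × τ ∼[ set ] map f σ
  ; closed = λ { {τ} τ⊆ (σ , Fσ , eq) →
      let σ′ , σ′⊆σ , τ≡ = unmap f τ (to eq ∘ τ⊆)
      in  σ′ , closed σ′⊆σ Fσ , λ {z} → mk⇔ (subst (z ∈ˡ_) τ≡) (subst (z ∈ˡ_) (sym τ≡)) }
  }
  where open Complex K

imageℤ₂ : ∀ {X Y : Set} (K : ℤ₂Complex X) (f : X → Y) (ν′ : Y → Y) →
          (∀ y → ν′ (ν′ y) ≡ y) →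
          (∀ {x} → ℤ₂Complex.Vertex K x → f (ℤ₂Complex.ν K x) ≡ ν′ (f x)) →
          ℤ₂Complex Y
imageℤ₂ {X} {Y} K f ν′ invol equiv = record
  { complex      = image f complex
  ; action       = record { fun = ν′ ; fun-face = λ {τ} → face τ }
  ; ν-involutive = λ {y} _ → invol y
  }
  where
  open ℤ₂Complex K
  face : ∀ τ → Complex.Face (image f complex) τ → Complex.Face (image f complex) (map ν′ τ)
  face τ (σ , Fσ , eq) = map ν σ , ν-face Fσ , λ {z} → mk⇔ there′ back
    where
    there′ : ∀ {z} → z ∈ˡ map ν′ τ → z ∈ˡ map f (map ν σ)
    there′ p with ∈-map⁻ ν′ p
    ... | y , y∈τ , refl with ∈-map⁻ f (to eq y∈τ)
    ... | x , x∈σ , refl = subst (_∈ˡ map f (map ν σ)) (equiv (vertex Fσ x∈σ))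
                             (∈-map⁺ f (∈-map⁺ ν x∈σ))
    back : ∀ {z} → z ∈ˡ map f (map ν σ) → z ∈ˡ map ν′ τ
    back p with ∈-map⁻ f p
    ... | _ , q , refl with ∈-map⁻ ν q
    ... | x , x∈σ , refl = subst (_∈ˡ map ν′ τ) (sym (equiv (vertex Fσ x∈σ)))
                             (∈-map⁺ ν′ (from eq (∈-map⁺ f x∈σ)))

Chain : ∀ {n} → Pred (List (Subset n)) 0ℓ
Chain = Linked _⊂_

module _ {n : ℕ} where

  _≟ˢ_ : DecidableEquality (Subset n)
  _≟ˢ_ = Vec.≡-dec Bool._≟_

  ⊆∧≢⇒⊂ : ∀ {A B : Subset n} → A ⊆ B → A ≢ B → A ⊂ B
  ⊆∧≢⇒⊂ {A} {B} A⊆B A≢B with Fin.any? (λ x → (x ∈? B) ×-dec (¬? (x ∈? A)))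
  ... | yes w = A⊆B , w
  ... | no ¬w = ⊥-elim (A≢B (⊆-antisym A⊆B B⊆A))
    where
    B⊆A : B ⊆ A
    B⊆A {x} x∈B with x ∈? A
    ... | yes x∈A = x∈A
    ... | no  x∉A = ⊥-elim (¬w (x , x∈B , x∉A))

  Comparable : Rel (Subset n) 0ℓ
  Comparable A B = A ⊆ B ⊎ B ⊆ A

  Chain⇒Comparable : ∀ {𝒜} → Chain 𝒜 → ∀ {A B} → A ∈ˡ 𝒜 → B ∈ˡ 𝒜 → Comparable A B
  Chain⇒Comparable = go ∘ Linked⇒AllPairs ⊂-trans
    where
    go : ∀ {𝒜} → AllPairs _⊂_ 𝒜 → ∀ {A B} → A ∈ˡ 𝒜 → B ∈ˡ 𝒜 → Comparable A B
    go (_ ∷ _)  (here refl) (here refl) = inj₁ id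
    go (p ∷ _)  (here refl) (there q)   = inj₁ (p⊂q⇒p⊆q (All.lookup p q))
    go (p ∷ _)  (there q)   (here refl) = inj₂ (p⊂q⇒p⊆q (All.lookup p q))
    go (_ ∷ ps) (there p)   (there q)   = go ps p q

  private
    insert : ∀ A 𝒜 → AllPairs _⊂_ 𝒜 → (∀ {B} → B ∈ˡ 𝒜 → Comparable A B) →
             ∃ λ 𝒞 → AllPairs _⊂_ 𝒞 × 𝒞 ∼[ set ] (A ∷ 𝒜)
    insert A [] _ _ = [ A ] , [] ∷ [] , mk⇔ id id
    insert A (B ∷ 𝒜) (B⊂ ∷ ps) cmp with A ≟ˢ B
    ... | yes refl = B ∷ 𝒜 , B⊂ ∷ ps ,
            mk⇔ there (λ { (here e) → here e ; (there q) → q })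
    ... | no A≢B with cmp (here refl)
    ...   | inj₁ A⊆B = A ∷ B ∷ 𝒜 ,
            (A⊂B ∷ All.map (⊂-trans A⊂B) B⊂) ∷ B⊂ ∷ ps , mk⇔ id id
      where A⊂B = ⊆∧≢⇒⊂ A⊆B A≢B
    ...   | inj₂ B⊆A with insert A 𝒜 ps (cmp ∘ there)
    ...     | 𝒞 , qs , eq = B ∷ 𝒞 , All.tabulate (λ {C} C∈ → below (to eq C∈)) ∷ qs ,
              mk⇔ (λ { (here e)  → there (here e)
                     ; (there q) → exchange (to eq q) })
                  (λ { (here e)          → there (from eq (here e))
                     ; (there (here e))  → here e
                     ; (there (there q)) → there (from eq (there q)) })
      where
      below : ∀ {C} → C ∈ˡ A ∷ 𝒜 → B ⊂ C
      below (here refl) = ⊆∧≢⇒⊂ B⊆A (A≢B ∘ sym)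
      below (there q)   = All.lookup B⊂ q
      exchange : ∀ {C} → C ∈ˡ A ∷ 𝒜 → C ∈ˡ A ∷ B ∷ 𝒜
      exchange (here e)  = here e
      exchange (there q) = there (there q)

  Comparable⇒Chain : ∀ 𝒜 → (∀ {A B} → A ∈ˡ 𝒜 → B ∈ˡ 𝒜 → Comparable A B) →
                     ∃ λ 𝒞 → Chain 𝒞 × 𝒞 ∼[ set ] 𝒜
  Comparable⇒Chain 𝒜 cmp = let 𝒞 , ps , eq = go 𝒜 cmp in 𝒞 , AllPairs⇒Linked ps , eq
    where
    go : ∀ 𝒜 → (∀ {A B} → A ∈ˡ 𝒜 → B ∈ˡ 𝒜 → Comparable A B) →
         ∃ λ 𝒞 → AllPairs _⊂_ 𝒞 × 𝒞 ∼[ set ] 𝒜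
    go [] _ = [] , [] , mk⇔ id id
    go (A ∷ 𝒜) cmp with go 𝒜 (λ p q → cmp (there p) (there q))
    ... | 𝒞 , ps , eq with insert A 𝒞 ps (λ B∈ → cmp (here refl) (there (to eq B∈)))
    ...   | 𝒞′ , ps′ , eq′ = 𝒞′ , ps′ ,
            mk⇔ (λ p → cons (to eq) (to eq′ p)) (λ p → from eq′ (cons (from eq) p))
      where
      cons : ∀ {C} {𝒳 𝒴 : List (Subset n)} → (C ∈ˡ 𝒳 → C ∈ˡ 𝒴) → C ∈ˡ A ∷ 𝒳 → C ∈ˡ A ∷ 𝒴
      cons f (here e)  = here e
      cons f (there q) = there (f q)

  filter-Chain : ∀ {P : Pred (Subset n) 0ℓ} (P? : ∀ A → Dec (P A)) {𝒜} →
                 Chain 𝒜 → Chain (filter P? 𝒜)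
  filter-Chain P? = AllPairs⇒Linked ∘ AllPairs.filter⁺ P? ∘ Linked⇒AllPairs ⊂-trans

  top : ∀ (𝒜 : List (Subset n)) → Chain 𝒜 →
        ∃ λ A → (A ≡ ⊥ ⊎ A ∈ˡ 𝒜) × (∀ {A′} → A′ ∈ˡ 𝒜 → A′ ⊆ A)
  top [] _ = ⊥ , inj₁ refl , λ ()
  top (A ∷ []) _ = A , inj₂ (here refl) , λ { (here refl) → id }
  top (A ∷ B ∷ 𝒜) (A⊂B ∷ ch) with top (B ∷ 𝒜) ch
  ... | C , C∈ , ≤C = C , Sum.map₂ there C∈ ,
    λ { (here refl) → ≤C (here refl) ∘ p⊂q⇒p⊆q A⊂B ; (there p) → ≤C p }

-- `inj₁ A` stands for the vertex A ⊎ ∅ and `inj₂ A` for ∅ ⊎ A.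
Point : ℕ → Set
Point n = Subset n ⊎ Subset n

module _ {n : ℕ} where

  infix 5 _⊎ˢ_

  _⊎ˢ_ : List (Subset n) → List (Subset n) → List (Point n)
  𝒜 ⊎ˢ ℬ = map inj₁ 𝒜 ++ map inj₂ ℬ

  ∈-⊎ˢ₁⁺ : ∀ {𝒜 ℬ A} → A ∈ˡ 𝒜 → inj₁ A ∈ˡ 𝒜 ⊎ˢ ℬ
  ∈-⊎ˢ₁⁺ p = ∈-++⁺ˡ (∈-map⁺ inj₁ p)

  ∈-⊎ˢ₂⁺ : ∀ {𝒜 ℬ B} → B ∈ˡ ℬ → inj₂ B ∈ˡ 𝒜 ⊎ˢ ℬ
  ∈-⊎ˢ₂⁺ {𝒜} p = ∈-++⁺ʳ (map inj₁ 𝒜) (∈-map⁺ inj₂ p)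

  ∈-⊎ˢ₁⁻ : ∀ {𝒜 ℬ A} → inj₁ A ∈ˡ 𝒜 ⊎ˢ ℬ → A ∈ˡ 𝒜
  ∈-⊎ˢ₁⁻ {𝒜} p with ∈-++⁻ (map inj₁ 𝒜) p
  ... | inj₁ q with ∈-map⁻ inj₁ q
  ...   | _ , r , refl = r
  ∈-⊎ˢ₁⁻ {𝒜} p | inj₂ q with ∈-map⁻ inj₂ q
  ...   | _ , _ , ()

  ∈-⊎ˢ₂⁻ : ∀ {𝒜 ℬ B} → inj₂ B ∈ˡ 𝒜 ⊎ˢ ℬ → B ∈ˡ ℬ
  ∈-⊎ˢ₂⁻ {𝒜} p with ∈-++⁻ (map inj₁ 𝒜) p
  ... | inj₂ q with ∈-map⁻ inj₂ q
  ...   | _ , r , refl = r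
  ∈-⊎ˢ₂⁻ {𝒜} p | inj₁ q with ∈-map⁻ inj₁ q
  ...   | _ , _ , ()

record Graph (n : ℕ) : Set₁ where
  infix 4 _~_ _~?_
  field
    _~_      : Rel (Fin n) 0ℓ
    _~?_     : Decidable _~_
    ~-sym    : Symmetric _~_
    ~-irrefl : Irreflexive _≡_ _~_

Connected : ∀ {n} → Graph n → Set
Connected G = ∀ u v → Star (Graph._~_ G) u v

module _ {n : ℕ} (G : Graph n) where
  open Graph G

  private
    common? : ∀ (A : Subset n) v → Dec (∀ a → a ∈ A → a ~ v)
    common? A v = all? λ a → (a ∈? A) →-dec (a ~? v)

  CN : Subset n → Subset n
  CN A = tabulate λ v → does (common? A v)

  CN² : Subset n → Subset n
  CN² A = CN (CN A)

  ∈-CN⁺ : ∀ {A v} → (∀ a → a ∈ A → a ~ v) → v ∈ CN A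
  ∈-CN⁺ {A} {v} h = Vec.lookup⇒[]= v (CN A)
    (trans (Vec.lookup∘tabulate _ v) (dec-true (common? A v) h))

  ∈-CN⁻ : ∀ {A v} → v ∈ CN A → ∀ a → a ∈ A → a ~ v
  ∈-CN⁻ {A} {v} v∈ with common? A v in eq
  ... | yes h = h
  ... | no  _ with trans (sym (Vec.[]=⇒lookup v∈))
                         (trans (Vec.lookup∘tabulate _ v) (cong does eq))
  ...   | ()

  CN-antitone : ∀ {A B} → A ⊆ B → CN B ⊆ CN A
  CN-antitone A⊆B v∈ = ∈-CN⁺ λ a a∈A → ∈-CN⁻ v∈ a (A⊆B a∈A)

  ⊆CN-sym : ∀ {A B} → A ⊆ CN B → B ⊆ CN A
  ⊆CN-sym A⊆ b∈B = ∈-CN⁺ λ a a∈A → ~-sym (∈-CN⁻ (A⊆ a∈A) _ b∈B)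

  ⊆CN² : ∀ {A} → A ⊆ CN² A
  ⊆CN² = ⊆CN-sym id

  CN-fixfree : ∀ {A} → Nonempty A → A ≢ CN A
  CN-fixfree {A} (a , a∈A) A≡ = ~-irrefl refl (∈-CN⁻ (subst (a ∈_) A≡ a∈A) a a∈A)

  -- Vertices of the barycentric subdivision of the neighborhood complex:
  -- the nonempty simplices of the latter.
  NVertex : Pred (Subset n) 0ℓ
  NVertex A = Nonempty A × Nonempty (CN A)

  LVertex : Pred (Subset n) 0ℓ
  LVertex A = NVertex A × CN² A ≡ A

  LFace : Pred (List (Subset n)) 0ℓ
  LFace σ = ∃ λ 𝒜 → Chain 𝒜 × All LVertex 𝒜 × σ ∼[ set ] 𝒜

  private
    open DecMembership (_≟ˢ_ {n}) using () renaming (_∈?_ to _∈ˢ?_)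

    LFace-closed : ∀ {σ τ} → σ ⊆ˡ τ → LFace τ → LFace σ
    LFace-closed {σ} σ⊆τ (𝒜 , ch , vs , eq) =
      filter (_∈ˢ? σ) 𝒜 , filter-Chain (_∈ˢ? σ) ch ,
      All.tabulate (λ p → All.lookup vs (proj₁ (∈-filter⁻ (_∈ˢ? σ) p))) ,
      mk⇔ (λ p → ∈-filter⁺ (_∈ˢ? σ) (to eq (σ⊆τ p)) p)
          (λ p → proj₂ (∈-filter⁻ (_∈ˢ? σ) {xs = 𝒜} p))

    LVertex-CN : ∀ {A} → LVertex A → LVertex (CN A)
    LVertex-CN ((ne , neCN) , fix) = (neCN , subst Nonempty (sym fix) ne) , cong CN fix

    LFace-CN : ∀ {σ} → LFace σ → LFace (map CN σ)
    LFace-CN {σ} (𝒜 , ch , vs , eq) =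
      let 𝒞 , ch′ , eq′ = Comparable⇒Chain (map CN 𝒜) cmp
      in  𝒞 , ch′ , All.tabulate (λ p → ok (to eq′ p)) ,
          mk⇔ (λ p → from eq′ (mapCN (to eq) p)) (λ p → mapCN (from eq) (to eq′ p))
      where
      cmp : ∀ {A B} → A ∈ˡ map CN 𝒜 → B ∈ˡ map CN 𝒜 → Comparable A B
      cmp p q with ∈-map⁻ CN p | ∈-map⁻ CN q
      ... | A , A∈ , refl | B , B∈ , refl =
        Sum.map CN-antitone CN-antitone (Chain⇒Comparable ch B∈ A∈)
      ok : ∀ {A} → A ∈ˡ map CN 𝒜 → LVertex A
      ok p with ∈-map⁻ CN p
      ... | A , A∈ , refl = LVertex-CN (All.lookup vs A∈)
      mapCN : ∀ {𝒳 𝒴 : List (Subset n)} → (∀ {A} → A ∈ˡ 𝒳 → A ∈ˡ 𝒴) →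
              ∀ {A} → A ∈ˡ map CN 𝒳 → A ∈ˡ map CN 𝒴
      mapCN f p with ∈-map⁻ CN p
      ... | A , A∈ , refl = ∈-map⁺ CN (f A∈)

  L : ℤ₂Complex (Subset n)
  L = record
    { complex      = record { Face = LFace ; closed = LFace-closed }
    ; action       = record { fun = CN ; fun-face = LFace-CN }
    ; ν-involutive = λ { (𝒜 , _ , vs , eq) → proj₂ (All.lookup vs (to eq (here refl))) }
    }

  -- By join⇒shore and shore⇒join below, these are the pairs of chains given by
  -- the joins sd (σ ∩ K₁) * sd (σ ∩ K₂), where σ ranges over the box complex and
  -- K₁, K₂ are its shores, except that the empty simplex is always present,
  -- even if there are no nodes.
  record IsShoreSimplex (𝒜 ℬ : List (Subset n)) : Set where
    field
      chain₁    : Chain 𝒜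
      chain₂    : Chain ℬ
      vertices₁ : All NVertex 𝒜
      vertices₂ : All NVertex ℬ
      adjacent  : ∀ {A B} → A ∈ˡ 𝒜 → B ∈ˡ ℬ → A ⊆ CN B

  -- A ⊎ B ∈ B(G); here A ∈ N(G) unfolds to Nonempty (CN A).
  Box : Rel (Subset n) 0ℓ
  Box A B = Nonempty (CN A) × Nonempty (CN B) × A ⊆ CN B × B ⊆ CN A

  -- The simplices of sd (σ ∩ K₁) * sd (σ ∩ K₂), for σ = A ⊎ B.
  record InJoin (A B : Subset n) (𝒜 ℬ : List (Subset n)) : Set where
    field
      chain₁ : Chain 𝒜
      chain₂ : Chain ℬ
      below₁ : All (λ A′ → Nonempty A′ × A′ ⊆ A) 𝒜
      below₂ : All (λ B′ → Nonempty B′ × B′ ⊆ B) ℬ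

  join⇒shore : ∀ {A B 𝒜 ℬ} → Box A B → InJoin A B 𝒜 ℬ → IsShoreSimplex 𝒜 ℬ
  join⇒shore (neA , neB , A⊆ , B⊆) s = record
    { chain₁    = chain₁
    ; chain₂    = chain₂
    ; vertices₁ = All.map (λ { (ne , ⊆A) → ne , Prod.map₂ (CN-antitone ⊆A) neA }) below₁
    ; vertices₂ = All.map (λ { (ne , ⊆B) → ne , Prod.map₂ (CN-antitone ⊆B) neB }) below₂
    ; adjacent  = λ p q → CN-antitone (proj₂ (All.lookup below₂ q))
                          ∘ A⊆ ∘ proj₂ (All.lookup below₁ p)
    }
    where open InJoin s

  shore⇒join : Fin n → ∀ {𝒜 ℬ} → IsShoreSimplex 𝒜 ℬ → ∃₂ λ A B → Box A B × InJoin A B 𝒜 ℬ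
  shore⇒join v {𝒜} {ℬ} s with top 𝒜 (IsShoreSimplex.chain₁ s) | top ℬ (IsShoreSimplex.chain₂ s)
  ... | A , A∈ , ≤A | B , B∈ , ≤B =
    A , B , (common vertices₁ A∈ , common vertices₂ B∈ , A⊆ A∈ B∈ , ⊆CN-sym (A⊆ A∈ B∈)) ,
    record
      { chain₁ = chain₁
      ; chain₂ = chain₂
      ; below₁ = All.tabulate λ p → proj₁ (All.lookup vertices₁ p) , ≤A p
      ; below₂ = All.tabulate λ p → proj₁ (All.lookup vertices₂ p) , ≤B p
      }
    where
    open IsShoreSimplex s
    common : ∀ {𝒳 X} → All NVertex 𝒳 → X ≡ ⊥ ⊎ X ∈ˡ 𝒳 → Nonempty (CN X)
    common _  (inj₁ refl) = v , ∈-CN⁺ λ _ → ⊥-elim ∘ ∉⊥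
    common vs (inj₂ p)    = proj₂ (All.lookup vs p)
    A⊆ : ∀ {A B} → A ≡ ⊥ ⊎ A ∈ˡ 𝒜 → B ≡ ⊥ ⊎ B ∈ˡ ℬ → A ⊆ CN B
    A⊆ (inj₁ refl) _           = ⊥-elim ∘ ∉⊥
    A⊆ (inj₂ _)    (inj₁ refl) = λ _ → ∈-CN⁺ λ _ → ⊥-elim ∘ ∉⊥
    A⊆ (inj₂ p)    (inj₂ q)    = adjacent p q

  SFace : Pred (List (Point n)) 0ℓ
  SFace σ = ∃₂ λ 𝒜 ℬ → IsShoreSimplex 𝒜 ℬ × σ ∼[ set ] (𝒜 ⊎ˢ ℬ)

  private
    open DecMembership (Sum.≡-dec (_≟ˢ_ {n}) (_≟ˢ_ {n})) using () renaming (_∈?_ to _∈ᵖ?_)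

    SFace-closed : ∀ {σ τ} → σ ⊆ˡ τ → SFace τ → SFace σ
    SFace-closed {σ} {τ} σ⊆τ (𝒜 , ℬ , s , eq) =
      𝒜′ , ℬ′ ,
      record
        { chain₁    = filter-Chain in₁? chain₁
        ; chain₂    = filter-Chain in₂? chain₂
        ; vertices₁ = All.tabulate (All.lookup vertices₁ ∘ proj₁ ∘ ∈-filter⁻ in₁?)
        ; vertices₂ = All.tabulate (All.lookup vertices₂ ∘ proj₁ ∘ ∈-filter⁻ in₂?)
        ; adjacent  = λ p q → adjacent (proj₁ (∈-filter⁻ in₁? p)) (proj₁ (∈-filter⁻ in₂? q))
        } ,
      mk⇔ forth back
      where
      open IsShoreSimplex s
      in₁? = λ A → inj₁ A ∈ᵖ? σ
      in₂? = λ B → inj₂ B ∈ᵖ? σ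
      𝒜′ = filter in₁? 𝒜
      ℬ′ = filter in₂? ℬ
      forth : ∀ {x} → x ∈ˡ σ → x ∈ˡ 𝒜′ ⊎ˢ ℬ′
      forth {inj₁ A} p = ∈-⊎ˢ₁⁺ {𝒜 = 𝒜′} (∈-filter⁺ in₁? (∈-⊎ˢ₁⁻ {𝒜 = 𝒜} (to eq (σ⊆τ p))) p)
      forth {inj₂ B} p = ∈-⊎ˢ₂⁺ {𝒜 = 𝒜′} (∈-filter⁺ in₂? (∈-⊎ˢ₂⁻ {𝒜 = 𝒜} (to eq (σ⊆τ p))) p)
      back : ∀ {x} → x ∈ˡ 𝒜′ ⊎ˢ ℬ′ → x ∈ˡ σ
      back {inj₁ A} p = proj₂ (∈-filter⁻ in₁? {xs = 𝒜} (∈-⊎ˢ₁⁻ {𝒜 = 𝒜′} p))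
      back {inj₂ B} p = proj₂ (∈-filter⁻ in₂? {xs = ℬ} (∈-⊎ˢ₂⁻ {𝒜 = 𝒜′} p))

    SFace-swap : ∀ {σ} → SFace σ → SFace (map swap σ)
    SFace-swap {σ} (𝒜 , ℬ , s , eq) =
      ℬ , 𝒜 ,
      record
        { chain₁    = chain₂
        ; chain₂    = chain₁
        ; vertices₁ = vertices₂
        ; vertices₂ = vertices₁
        ; adjacent  = λ p q → ⊆CN-sym (adjacent q p)
        } ,
      mk⇔ forth back
      where
      open IsShoreSimplex s
      forth : ∀ {x} → x ∈ˡ map swap σ → x ∈ˡ ℬ ⊎ˢ 𝒜
      forth p with ∈-map⁻ swap p
      ... | inj₁ A , q , refl = ∈-⊎ˢ₂⁺ {𝒜 = ℬ} (∈-⊎ˢ₁⁻ (to eq q))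
      ... | inj₂ B , q , refl = ∈-⊎ˢ₁⁺ (∈-⊎ˢ₂⁻ {𝒜 = 𝒜} (to eq q))
      back : ∀ {x} → x ∈ˡ ℬ ⊎ˢ 𝒜 → x ∈ˡ map swap σ
      back {inj₁ B} p = ∈-map⁺ swap (from eq (∈-⊎ˢ₂⁺ {𝒜 = 𝒜} (∈-⊎ˢ₁⁻ p)))
      back {inj₂ A} p = ∈-map⁺ swap (from eq (∈-⊎ˢ₁⁺ (∈-⊎ˢ₂⁻ {𝒜 = ℬ} p)))

    swap-swap : ∀ (x : Point n) → swap (swap x) ≡ x
    swap-swap (inj₁ _) = refl
    swap-swap (inj₂ _) = refl

  ssdB : ℤ₂Complex (Point n)
  ssdB = record
    { complex      = record { Face = SFace ; closed = SFace-closed }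
    ; action       = record { fun = swap ; fun-face = SFace-swap }
    ; ν-involutive = λ {x} _ → swap-swap x
    }

  DL : ℤ₂Complex (Point n)
  DL = imageℤ₂ ssdB (Sum.map CN² CN²) swap swap-swap
         λ { {inj₁ _} _ → refl ; {inj₂ _} _ → refl }

  DL-nonempty : ∀ {x} → ℤ₂Complex.Vertex DL x → Nonempty (Sum.reduce x)
  DL-nonempty (ρ , Sρ , eq) with ∈-map⁻ (Sum.map CN² CN²) (to eq (here refl))
  DL-nonempty (ρ , (𝒜 , ℬ , s , eq′) , eq) | inj₁ A , p , refl
    with All.lookup (IsShoreSimplex.vertices₁ s) (∈-⊎ˢ₁⁻ (to eq′ p))
  ... | (a , a∈A) , _ = a , ⊆CN² a∈A
  DL-nonempty (ρ , (𝒜 , ℬ , s , eq′) , eq) | inj₂ B , p , refl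
    with All.lookup (IsShoreSimplex.vertices₂ s) (∈-⊎ˢ₂⁻ {𝒜 = 𝒜} (to eq′ p))
  ... | (b , b∈B) , _ = b , ⊆CN² b∈B

module VertexOrder {n : ℕ} {_≤_ : Rel (Fin n) 0ℓ}
                   (isDecTotalOrder : IsDecTotalOrder _≡_ _≤_) where

  open IsDecTotalOrder isDecTotalOrder using (antisym; total; _≤?_)
  private
    decTotalOrder : DecTotalOrder 0ℓ 0ℓ 0ℓ
    decTotalOrder = record { isDecTotalOrder = isDecTotalOrder }
  open Sort decTotalOrder using (sort; sort-↭)

  elements : Subset n → List (Fin n)
  elements A = sort (filter (_∈? A) (allFin n))

  infix 4 _<ˡᵉˣ_ _≺_ _≺?_

  _<ˡᵉˣ_ : Rel (Subset n) 0ℓ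
  A <ˡᵉˣ B = Lex-< _≡_ _≤_ (elements A) (elements B)

  _≺_ : Rel (Subset n) 0ℓ
  A ≺ B = ∣ A ∣ < ∣ B ∣ ⊎ (∣ A ∣ ≡ ∣ B ∣ × A <ˡᵉˣ B)

  _≺?_ : Decidable _≺_
  A ≺? B = (∣ A ∣ ℕ.<? ∣ B ∣) ⊎-dec
           ((∣ A ∣ ℕ.≟ ∣ B ∣) ×-dec <-decidable Fin._≟_ _≤?_ (elements A) (elements B))

  ∈-elements⁺ : ∀ {A x} → x ∈ A → x ∈ˡ elements A
  ∈-elements⁺ {A} {x} p = ∈-resp-↭ (↭-sym (sort-↭ _)) (∈-filter⁺ (_∈? A) (∈-allFin x) p)

  ∈-elements⁻ : ∀ {A x} → x ∈ˡ elements A → x ∈ A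
  ∈-elements⁻ {A} p = proj₂ (∈-filter⁻ (_∈? A) {xs = allFin n} (∈-resp-↭ (sort-↭ _) p))

  elements-injective : ∀ {A B} → elements A ≡ elements B → A ≡ B
  elements-injective eq = ⊆-antisym
    (λ p → ∈-elements⁻ (subst (_ ∈ˡ_) eq (∈-elements⁺ p)))
    (λ p → ∈-elements⁻ (subst (_ ∈ˡ_) (sym eq) (∈-elements⁺ p)))

  ≺-compare : ∀ A B → Tri (A ≺ B) (A ≡ B) (B ≺ A)
  ≺-compare A B with ℕ.<-cmp ∣ A ∣ ∣ B ∣
  ... | tri< a ¬b ¬c = tri< (inj₁ a) (λ { refl → ¬b refl })
                         λ { (inj₁ c) → ¬c c ; (inj₂ (e , _)) → ¬b (sym e) }
  ... | tri> ¬a ¬b c = tri> (λ { (inj₁ a) → ¬a a ; (inj₂ (e , _)) → ¬b e })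
                         (λ { refl → ¬b refl }) (inj₁ c)
  ... | tri≈ ¬a e ¬c with <-compare sym Fin._≟_ antisym total (elements A) (elements B)
  ...   | tri< l ¬m ¬r = tri< (inj₂ (e , l)) (λ { refl → ¬m (≡⇒Pointwise-≡ refl) })
                           λ { (inj₁ c) → ¬c c ; (inj₂ (_ , r)) → ¬r r }
  ...   | tri≈ ¬l m ¬r = tri≈ (λ { (inj₁ a) → ¬a a ; (inj₂ (_ , l)) → ¬l l })
                           (elements-injective (Pointwise-≡⇒≡ m))
                           λ { (inj₁ c) → ¬c c ; (inj₂ (_ , r)) → ¬r r }
  ...   | tri> ¬l ¬m r = tri> (λ { (inj₁ a) → ¬a a ; (inj₂ (_ , l)) → ¬l l })
                           (λ { refl → ¬m (≡⇒Pointwise-≡ refl) }) (inj₂ (sym e , r))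

module _ {n : ℕ} (G : Graph n) {_≤_ : Rel (Fin n) 0ℓ}
         (isDecTotalOrder : IsDecTotalOrder _≡_ _≤_) where

  open VertexOrder isDecTotalOrder

  -- A ⊎ ∅ precedes ∅ ⊎ CN A iff A ≺ CN A; in particular CN B ⊎ ∅ precedes
  -- ∅ ⊎ B = ∅ ⊎ CN² B iff CN B ≺ B.
  j : Point n → Point n
  j (inj₁ A) = if does (A ≺? CN G A) then inj₁ A else inj₂ (CN G A)
  j (inj₂ B) = if does (CN G B ≺? B) then inj₁ (CN G B) else inj₂ B

  private
    j-swap : ∀ x → Nonempty (Sum.reduce x) → j (swap x) ≡ swap (j x)
    j-swap (inj₁ A) ne with ≺-compare A (CN G A)
    ... | tri< a _ ¬c rewrite dec-true (A ≺? CN G A) a | dec-false (CN G A ≺? A) ¬c = refl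
    ... | tri≈ _ e _  = ⊥-elim (CN-fixfree G ne e)
    ... | tri> ¬a _ c rewrite dec-false (A ≺? CN G A) ¬a | dec-true (CN G A ≺? A) c = refl
    j-swap (inj₂ B) ne with ≺-compare B (CN G B)
    ... | tri< a _ ¬c rewrite dec-true (B ≺? CN G B) a | dec-false (CN G B ≺? B) ¬c = refl
    ... | tri≈ _ e _  = ⊥-elim (CN-fixfree G ne e)
    ... | tri> ¬a _ c rewrite dec-false (B ≺? CN G B) ¬a | dec-true (CN G B ≺? B) c = refl

  HDL : ℤ₂Complex (Point n)
  HDL = imageℤ₂ (DL G) j swap (λ { (inj₁ _) → refl ; (inj₂ _) → refl })
          λ {x} v → j-swap x (DL-nonempty G v)

{-# OPTIONS --safe #-}

-- On vertices the isomorphism is A ↦ j (A ⊎ ∅), with inverse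
-- A ⊎ ∅ ↦ A, ∅ ⊎ B ↦ CN B.  Both members of a pair {A ⊎ ∅, ∅ ⊎ CN A} are sent to A
-- by the latter, so it does not see j.  It is simplicial because A ⊆ CN B for
-- all A ∈ 𝒜, B ∈ ℬ makes 𝒜 ∪ {CN B : B ∈ ℬ} a chain.
module Submission where

open import Defs
open import Data.Bool.Base using (true; false; if_then_else_)
open import Data.Empty using (⊥-elim)
open import Data.Fin.Base using (Fin)
open import Data.Fin.Subset using (Subset; _⊆_; Nonempty)
open import Data.Fin.Subset.Properties using (⊆-antisym)
open import Data.List.Base using (List; []; map)
open import Data.List.Membership.Propositional using () renaming (_∈_ to _∈ˡ_)
open import Data.List.Membership.Propositional.Properties using (∈-map⁺; ∈-map⁻)
open import Data.List.Properties using (map-∘)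
open import Data.List.Relation.Unary.All using ([])
import Data.List.Relation.Unary.All as All
open import Data.List.Relation.Unary.Any using (here)
open import Data.List.Relation.Unary.Linked using ([])
open import Data.Nat.Base using (ℕ)
open import Data.Product.Base using (∃; _×_; _,_; proj₁; proj₂)
import Data.Product.Base as Prod
open import Data.Sum.Base using (inj₁; inj₂; [_,_]; swap; reduce)
import Data.Sum.Base as Sum
open import Function.Base using (_∘_; id)
open import Function.Bundles using (Equivalence; mk⇔)
open import Level using (0ℓ)
open import Relation.Binary.Core using (Rel)
open import Relation.Binary.Definitions using (tri<; tri≈; tri>)
open import Relation.Binary.PropositionalEquality
  using (_≡_; refl; sym; trans; cong; subst)
open import Relation.Binary.Structures using (IsDecTotalOrder)
open import Relation.Nullary using (does)
open import Relation.Nullary.Decidable using (dec-true; dec-false)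

open Equivalence using (to; from)

module _ {n : ℕ} (G : Graph n) where

  CN³≡CN : ∀ A → CN² G (CN G A) ≡ CN G A
  CN³≡CN A = ⊆-antisym (CN-antitone G (⊆CN² G)) (⊆CN² G)

  CN²-mono : ∀ {A B} → A ⊆ B → CN² G A ⊆ CN² G B
  CN²-mono A⊆B = CN-antitone G (CN-antitone G A⊆B)

  NVertex-CN : ∀ {A} → NVertex G A → NVertex G (CN G A)
  NVertex-CN (ne , neCN) = neCN , Prod.map₂ (⊆CN² G) ne

  LVertex-CN² : ∀ {A} → NVertex G A → LVertex G (CN² G A)
  LVertex-CN² {A} v = NVertex-CN (NVertex-CN v) , CN³≡CN (CN G A)

  comparable⇒LFace : ∀ {σ} → (∀ {A} → A ∈ˡ σ → LVertex G A) →
                     (∀ {A B} → A ∈ˡ σ → B ∈ˡ σ → Comparable A B) → LFace G σ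
  comparable⇒LFace {σ} vs cmp =
    let 𝒞 , ch , eq = Comparable⇒Chain σ cmp
    in  𝒞 , ch , All.tabulate (λ p → vs (to eq p)) , mk⇔ (from eq) (to eq)

  merge : Point n → Subset n
  merge = [ id , CN G ]

  close : Point n → Point n
  close = Sum.map (CN² G) (CN² G)

  -- Holds at every vertex of `DL`. `Point n` also contains sets not fixed by `CN²`, and there
  -- `merge` may distinguish `x` from its image under `j`.
  Closed : Point n → Set
  Closed x = CN² G (reduce x) ≡ reduce x

  close-Closed : ∀ x → Closed (close x)
  close-Closed (inj₁ A) = CN³≡CN (CN G A)
  close-Closed (inj₂ B) = CN³≡CN (CN G B)

  -- Stated before closing, since a face of `DL` is given only as the `close`-image of some `ρ`. On
  -- the second shore `CN (CN² B)` unfolds to `CN² (CN B)`, again a closure.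
  SFace⇒LVertex : ∀ {ρ} → SFace G ρ → ∀ {x} → x ∈ˡ ρ → LVertex G (merge (close x))
  SFace⇒LVertex (𝒜 , ℬ , s , eq) {inj₁ A} p =
    LVertex-CN² (All.lookup (IsShoreSimplex.vertices₁ s) (∈-⊎ˢ₁⁻ (to eq p)))
  SFace⇒LVertex (𝒜 , ℬ , s , eq) {inj₂ B} p =
    LVertex-CN² (NVertex-CN (All.lookup (IsShoreSimplex.vertices₂ s) (∈-⊎ˢ₂⁻ {𝒜 = 𝒜} (to eq p))))

  SFace⇒Comparable : ∀ {ρ} → SFace G ρ → ∀ {x y} → x ∈ˡ ρ → y ∈ˡ ρ →
                     Comparable (merge (close x)) (merge (close y))
  SFace⇒Comparable (𝒜 , ℬ , s , eq) {x} {y} p q = go x y (to eq p) (to eq q)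
    where
    open IsShoreSimplex s
    go : ∀ x y → x ∈ˡ 𝒜 ⊎ˢ ℬ → y ∈ˡ 𝒜 ⊎ˢ ℬ → Comparable (merge (close x)) (merge (close y))
    go (inj₁ A) (inj₁ A′) p q =
      Sum.map CN²-mono CN²-mono (Chain⇒Comparable chain₁ (∈-⊎ˢ₁⁻ p) (∈-⊎ˢ₁⁻ q))
    -- Adjacency is `A ⊆ CN B`; closing both sides compares `CN² A` with `CN² (CN B)`.
    go (inj₁ A) (inj₂ B)  p q = inj₁ (CN²-mono (adjacent (∈-⊎ˢ₁⁻ p) (∈-⊎ˢ₂⁻ {𝒜 = 𝒜} q)))
    go (inj₂ B) (inj₁ A)  p q = inj₂ (CN²-mono (adjacent (∈-⊎ˢ₁⁻ q) (∈-⊎ˢ₂⁻ {𝒜 = 𝒜} p)))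
    -- `CN ∘ CN²` reverses inclusions, hence `q` before `p` below.
    go (inj₂ B) (inj₂ B′) p q =
      Sum.map (CN-antitone G ∘ CN²-mono) (CN-antitone G ∘ CN²-mono)
        (Chain⇒Comparable chain₂ (∈-⊎ˢ₂⁻ {𝒜 = 𝒜} q) (∈-⊎ˢ₂⁻ {𝒜 = 𝒜} p))

  DLFace : List (Point n) → Set
  DLFace = ℤ₂Complex.Face (DL G)

  DLFace⇒Closed : ∀ {σ} → DLFace σ → ∀ {x} → x ∈ˡ σ → Closed x
  DLFace⇒Closed (ρ , _ , eq) p with ∈-map⁻ close (to eq p)
  ... | x , _ , refl = close-Closed x

  DLFace⇒LFace : ∀ {σ} → DLFace σ → LFace G (map merge σ)
  DLFace⇒LFace {σ} (ρ , Sρ , eq) = comparable⇒LFace vs cmp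
    where
    preimage : ∀ {A} → A ∈ˡ map merge σ → ∃ λ x → x ∈ˡ ρ × A ≡ merge (close x)
    preimage p with ∈-map⁻ merge p
    ... | _ , q , refl with ∈-map⁻ close (to eq q)
    ... | x , r , refl = x , r , refl
    vs : ∀ {A} → A ∈ˡ map merge σ → LVertex G A
    vs p with preimage p
    ... | _ , q , refl = SFace⇒LVertex Sρ q
    cmp : ∀ {A B} → A ∈ˡ map merge σ → B ∈ˡ map merge σ → Comparable A B
    cmp p q with preimage p | preimage q
    ... | _ , p′ , refl | _ , q′ , refl = SFace⇒Comparable Sρ p′ q′

  -- With an empty second chain, adjacency is vacuous, and `close` fixes the points of the first, so
  -- the simplex is its own image.
  LFace⇒DLFace : ∀ {σ} → LFace G σ → DLFace (map inj₁ σ)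
  LFace⇒DLFace {σ} (𝒜 , ch , vs , eq) =
    𝒜 ⊎ˢ [] , (𝒜 , [] , simplex , mk⇔ id id) , mk⇔ forth back
    where
    simplex : IsShoreSimplex G 𝒜 []
    simplex = record
      { chain₁    = ch
      ; chain₂    = []
      ; vertices₁ = All.map proj₁ vs
      ; vertices₂ = []
      ; adjacent  = λ _ ()
      }
    fixed : ∀ {A} → A ∈ˡ 𝒜 → CN² G A ≡ A
    fixed p = proj₂ (All.lookup vs p)
    forth : ∀ {x} → x ∈ˡ map inj₁ σ → x ∈ˡ map close (𝒜 ⊎ˢ [])
    forth p with ∈-map⁻ inj₁ p
    ... | A , q , refl = subst (λ X → inj₁ X ∈ˡ map close (𝒜 ⊎ˢ [])) (fixed (to eq q))
                           (∈-map⁺ close (∈-⊎ˢ₁⁺ (to eq q)))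
    back : ∀ {x} → x ∈ˡ map close (𝒜 ⊎ˢ []) → x ∈ˡ map inj₁ σ
    back p with ∈-map⁻ close p
    ... | inj₁ A , q , refl = subst (λ X → inj₁ X ∈ˡ map inj₁ σ) (sym (fixed A∈𝒜))
                                (∈-map⁺ inj₁ (from eq A∈𝒜))
      where A∈𝒜 = ∈-⊎ˢ₁⁻ q
    ... | inj₂ B , q , refl with ∈-⊎ˢ₂⁻ {𝒜 = 𝒜} q
    ...   | ()

  module _ {_≤_ : Rel (Fin n) 0ℓ} (ord : IsDecTotalOrder _≡_ _≤_) where
    open VertexOrder ord

    merge-j : ∀ {x} → Closed x → merge (j G ord x) ≡ merge x
    merge-j {inj₁ A} fix with does (A ≺? CN G A)
    ... | true  = refl
    -- Here `j` moves to `inj₂ (CN A)`, which `merge` sends to `CN² A`.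
    ... | false = fix
    merge-j {inj₂ B} fix with does (CN G B ≺? B)
    ... | true  = refl
    ... | false = refl

    -- `inj₁ (merge x)` lies in the pair of `x`, and `j` depends only on the pair. For `inj₂ B` the
    -- two sides differ only in having `CN² B` in place of `B`.
    j-merge : ∀ {x} → Closed x → j G ord (inj₁ (merge x)) ≡ j G ord x
    j-merge {inj₁ A} _   = refl
    j-merge {inj₂ B} fix =
      cong (λ X → if does (CN G B ≺? X) then inj₁ (CN G B) else inj₂ X) fix

    -- The two sides test `CN A ≺ A` and `A ≺ CN A`. Exactly one holds: equality is impossible
    -- because a nonempty `A` with `A ≡ CN A` would give a loop.
    swap-j : ∀ {A} → Nonempty A → j G ord (inj₂ A) ≡ swap (j G ord (inj₁ A))
    swap-j {A} ne with ≺-compare A (CN G A)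
    ... | tri< a _ ¬c rewrite dec-true (A ≺? CN G A) a | dec-false (CN G A ≺? A) ¬c = refl
    ... | tri≈ _ e _  = ⊥-elim (CN-fixfree G ne e)
    ... | tri> ¬a _ c rewrite dec-false (A ≺? CN G A) ¬a | dec-true (CN G A ≺? A) c = refl

    HDLFace : List (Point n) → Set
    HDLFace = ℤ₂Complex.Face (HDL G ord)

    LFace⇒HDLFace : ∀ {σ} → LFace G σ → HDLFace (map (j G ord ∘ inj₁) σ)
    LFace⇒HDLFace {σ} Lσ = map inj₁ σ , LFace⇒DLFace Lσ ,
      λ {z} → mk⇔ (subst (z ∈ˡ_) (map-∘ σ)) (subst (z ∈ˡ_) (sym (map-∘ σ)))

    -- `τ` is the `j`-image of a face `σ` of `DL`. By `merge-j`, merging `τ` yields nothing outside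
    -- the merge of `σ`.
    HDLFace⇒LFace : ∀ {τ} → HDLFace τ → LFace G (map merge τ)
    HDLFace⇒LFace {τ} (σ , Dσ , eq) = ℤ₂Complex.closed (L G) τ⊆σ (DLFace⇒LFace Dσ)
      where
      τ⊆σ : ∀ {A} → A ∈ˡ map merge τ → A ∈ˡ map merge σ
      τ⊆σ p with ∈-map⁻ merge p
      ... | _ , q , refl with ∈-map⁻ (j G ord) (to eq q)
      ... | x , r , refl = subst (_∈ˡ map merge σ) (sym (merge-j {x} (DLFace⇒Closed Dσ r)))
                             (∈-map⁺ merge r)

    -- Write `y` as `j x` with `x` closed: `merge` forgets this `j`, and `j-merge` restores it.
    j-merge-HDL : ∀ {y} → ℤ₂Complex.Vertex (HDL G ord) y → j G ord (inj₁ (merge y)) ≡ y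
    j-merge-HDL (σ , Dσ , eq) with ∈-map⁻ (j G ord) (to eq (here refl))
    ... | x , p , refl =
      trans (cong (j G ord ∘ inj₁) (merge-j {x} closed)) (j-merge {x} closed)
      where closed = DLFace⇒Closed Dσ p

theorem2 : ∀ {n : ℕ} (G : Graph n) → Connected G →
    {_≤_ : Rel (Fin n) 0ℓ} (≤-isDecTotalOrder : IsDecTotalOrder _≡_ _≤_) →
    L G ≅ HDL G ≤-isDecTotalOrder
theorem2 G _ ord = record
  { forward     = record { fun = j G ord ∘ inj₁ ; fun-face = LFace⇒HDLFace G ord }
  ; backward    = record { fun = merge G ; fun-face = HDLFace⇒LFace G ord }
  ; inverseˡ    = λ {A} v → merge-j G ord {inj₁ A} (proj₂ (LVertex-of v))
  ; inverseʳ    = j-merge-HDL G ord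
  -- `CN A` is `merge (inj₂ A)`, so the image of `CN A` is `j (inj₂ A)`.
  ; equivariant = λ {A} v → trans (j-merge G ord {inj₂ A} (proj₂ (LVertex-of v)))
                                  (swap-j G ord (proj₁ (proj₁ (LVertex-of v))))
  }
  where
  LVertex-of : ∀ {A} → ℤ₂Complex.Vertex (L G) A → LVertex G A
  LVertex-of (_ , _ , vs , eq) = All.lookup vs (to eq (here refl))
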